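{- For every integer $n\ge 1$, $|\mathcal{S}_n(31;\,3\to 2)| = B_n$, where $B_n$ is the $n$-th Bell number.
   Context: $[n]=\{1,\dots,n\}$, and $\mathcal{S}_n$ is the set of permutations $\pi=\pi_1\pi_2\cdots\pi_n$ of $[n]$ in one-line notation. The permutation $\hat\pi$: for $\pi\in\mathcal{S}_n$, $\hat\pi\in\mathcal{S}_n$ is the permutation whose cycle form is obtained from the word $\pi_1\cdots\pi_n$ by inserting a left parenthesis before each left-to-right maximum (an entry larger than all entries to its left) and a right parenthesis immediately before the next left-to-right maximum, or at the end of the word. A cycle $(c_1,c_2,\dots,c_s)$ means $c_1\mapsto c_2\mapsto\cdots\mapsto c_s\mapsto c_1$. Example: if $\pi=2537164$ then $\hat\pi=(2)(53)(7164)$. Arrow patterns: an arrow pattern of size $k$ is a pair $(\nu;H)$ where $\nu=\nu_1\cdots\nu_m$ is a word of distinct positive integers, $H$ is a collection of arrows $b_i\to c_i$, and the set of all integers appearing in $\nu$ or $H$ is $[k]$. A permutation $\pi\in\mathcal{S}_n$ contains $(\nu;H)$ if there are a set $X=\{x_1<x_2<\cdots<x_k\}\subseteq[n]$ and indices $t_1<\cdots<t_m$ such that $\pi_{t_1}\pi_{t_2}\cdots\pi_{t_m}=x_{\nu_1}x_{\nu_2}\cdots x_{\nu_m}$ and $\hat\pi(x_{b_i})=x_{c_i}$ for every arrow $b_i\to c_i$ in $H$. Otherwise $\pi$ avoids $(\nu;H)$. $\mathcal{S}_n(\nu;H)$ is the set of permutations in $\mathcal{S}_n$ avoiding $(\nu;H)$.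 The Bell number $B_n$ is the number of set partitions of $[n]$. -}

module Defs where

open import Data.Bool.Base using (if_then_else_)
open import Data.Fin.Base using (Fin; _<_)
open import Data.Fin.Patterns using (0F; 1F; 2F; 3F; 4F; 5F; 6F)
open import Data.Fin.Properties using (_≟_; _<?_; all?)
open import Data.Fin.Subset using (Subset; inside; outside; Nonempty; Empty; _∩_) renaming (_∈_ to _∈ˢ_)
open import Data.Fin.Subset.Properties using (nonempty?) renaming (_∈?_ to _∈ˢ?_)
open import Data.List.Base as List
  using (List; []; _∷_; [_]; _++_; length; filter; foldr; allFin; cartesianProductWith)
open import Data.List.Membership.Propositional using (_∈_; lose)
open import Data.List.Membership.Propositional.Properties
  using (∈-cartesianProductWith⁺; ∈-allFin; ∈-map⁺; ∈-map⁻; ∈-++⁺ˡ; ∈-++⁺ʳ; ∈-++⁻)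
import Data.List.Relation.Binary.Sublist.Propositional as Sublist
open Sublist using (_⊆_; []; _∷_; _∷ʳ_)
open import Data.List.Relation.Unary.All as All using (All)
open import Data.List.Relation.Unary.AllPairs as AllPairs using (AllPairs; []; _∷_)
open import Data.List.Relation.Unary.Any as Any using (Any; here; there)
open import Data.List.Relation.Unary.Unique.Propositional using (Unique)
import Data.List.Relation.Unary.Unique.Propositional.Properties as Unique
open import Data.Nat.Base using (ℕ; zero; suc)
open import Data.Product.Base using (_×_; _,_; ∃)
open import Data.Sum.Base using (_⊎_; inj₁; inj₂)
open import Data.Vec.Base as Vec using (Vec; []; _∷_; lookup)
open import Data.Vec.Membership.Propositional using () renaming (_∈_ to _∈ᵛ_)
open import Data.Vec.Properties using (∷-injective; ≡-dec)
import Data.Vec.Relation.Unary.All as Vecᴬ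
import Data.Vec.Relation.Unary.AllPairs as Vecᴾ
import Data.Vec.Relation.Unary.Any as Vecᴱ
import Data.Vec.Relation.Unary.Unique.Propositional as Vecᵁ
open import Relation.Binary.PropositionalEquality using (_≡_; refl)
open import Relation.Nullary.Decidable using (Dec; does; yes; no; map′; ¬?; _×-dec_)
open import Relation.Nullary.Negation using (¬_)
open import Relation.Unary using (Decidable)
import Data.List.Properties as Listₚ

-- The set [n] is represented by Fin n, so every value is shifted down by one.

------------------------------------------------------------------------
-- Enumerations

vecs : {A : Set} → List A → ∀ m → List (Vec A m)
vecs xs zero    = [ [] ]
vecs xs (suc m) = cartesianProductWith _∷_ xs (vecs xs m)

∈-vecs⁺ : {A : Set} {xs : List A} → (∀ x → x ∈ xs) →
          ∀ {m} (v : Vec A m) → v ∈ vecs xs m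
∈-vecs⁺ all∈ []      = here refl
∈-vecs⁺ all∈ (x ∷ v) = ∈-cartesianProductWith⁺ _∷_ (all∈ x) (∈-vecs⁺ all∈ v)

vecs-unique : {A : Set} {xs : List A} → Unique xs → ∀ m → Unique (vecs xs m)
vecs-unique u zero    = All.[] ∷ []
vecs-unique u (suc m) = Unique.cartesianProductWith⁺ _∷_ ∷-injective u (vecs-unique u m)

sublists : {A : Set} → List A → List (List A)
sublists []       = [ [] ]
sublists (x ∷ xs) = List.map (x ∷_) (sublists xs) ++ sublists xs

∈-sublists⁺ : {A : Set} {xs ys : List A} → ys ⊆ xs → ys ∈ sublists xs
∈-sublists⁺ []          = here refl
∈-sublists⁺ (x ∷ʳ s)    = ∈-++⁺ʳ (List.map (x ∷_) _) (∈-sublists⁺ s)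
∈-sublists⁺ (refl ∷ s)  = ∈-++⁺ˡ (∈-map⁺ (_ ∷_) (∈-sublists⁺ s))

∈-sublists⁻ : {A : Set} (xs : List A) {ys : List A} → ys ∈ sublists xs → ys ⊆ xs
∈-sublists⁻ []       (here refl) = []
∈-sublists⁻ (x ∷ xs) ys∈ with ∈-++⁻ (List.map (x ∷_) (sublists xs)) ys∈
... | inj₂ q = x ∷ʳ ∈-sublists⁻ xs q
... | inj₁ q with ∈-map⁻ (x ∷_) q
...   | zs , zs∈ , refl = refl ∷ ∈-sublists⁻ xs zs∈

sublists-unique : {A : Set} {xs : List A} → Unique xs → Unique (sublists xs)
sublists-unique []                    = All.[] ∷ []
sublists-unique {xs = x ∷ xs} (x∉ ∷ u) =
  Unique.++⁺ (Unique.map⁺ Listₚ.∷-injectiveʳ (sublists-unique u)) (sublists-unique u) disjoint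
  where
  disjoint : ∀ {ys} → ¬ (ys ∈ List.map (x ∷_) (sublists xs) × ys ∈ sublists xs)
  disjoint (p , q) with ∈-map⁻ (x ∷_) p
  ... | zs , _ , refl = All.lookup x∉ (Sublist.lookup (∈-sublists⁻ xs q) (here refl)) refl

∃-vec? : ∀ {n m} {P : Vec (Fin n) m → Set} → Decidable P → Dec (∃ P)
∃-vec? {n} {m} P? =
  map′ Any.satisfied (λ (v , pv) → lose (∈-vecs⁺ ∈-allFin v) pv) (Any.any? P? (vecs (allFin n) m))

------------------------------------------------------------------------
-- Permutations in one-line notation

Word : ℕ → Set
Word n = Vec (Fin n) n

-- A word of length n over [n] is a permutation iff its entries are distinct.
permutations : ∀ n → List (Word n)
permutations n = filter (Vecᴾ.allPairs? λ a b → ¬? (a ≟ b)) (vecs (allFin n) n)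

------------------------------------------------------------------------
-- The permutation π̂

-- In  run M w  the word w is what follows a left-to-right maximum M and
-- entries smaller than M, so an entry of w is a left-to-right maximum iff it
-- exceeds the largest entry seen so far.  The result is the rest of the cycle
-- opened by M, together with the later cycles.
run : ∀ {n} → Fin n → List (Fin n) → List (Fin n) × List (List (Fin n))
run M []      = [] , []
run M (b ∷ w) with M <? b
... | yes _ = let c , cs = run b w in [] , (b ∷ c) ∷ cs
... | no  _ = let c , cs = run M w in b ∷ c , cs

cycles : ∀ {n} → List (Fin n) → List (List (Fin n))
cycles []      = []
cycles (a ∷ w) = let c , cs = run a w in (a ∷ c) ∷ cs

cycle : ∀ {n} → List (Fin n) → Fin n → Fin n
cycle []            x = x
cycle {n} (c₁ ∷ cs) x = go c₁ cs
  where
  go : Fin n → List (Fin n) → Fin n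
  go c []       = if does (x ≟ c) then c₁ else x
  go c (d ∷ ds) = if does (x ≟ c) then d else go d ds

-- For a permutation the cycles are disjoint, so the order of composition is
-- immaterial.
hat : ∀ {n} → Word n → Fin n → Fin n
hat π x = foldr cycle x (cycles (Vec.toList π))

-- π = 2537164 gives (2)(53)(7164).
_ : cycles {7} (1F ∷ 4F ∷ 2F ∷ 6F ∷ 0F ∷ 5F ∷ 3F ∷ [])
    ≡ (1F ∷ []) ∷ (4F ∷ 2F ∷ []) ∷ (6F ∷ 0F ∷ 5F ∷ 3F ∷ []) ∷ []
_ = refl

_ : Vec.tabulate (hat {7} (1F ∷ 4F ∷ 2F ∷ 6F ∷ 0F ∷ 5F ∷ 3F ∷ []))
    ≡ 5F ∷ 1F ∷ 4F ∷ 6F ∷ 2F ∷ 3F ∷ 0F ∷ []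
_ = refl

------------------------------------------------------------------------
-- Arrow patterns

record ArrowPattern : Set where
  field
    size     : ℕ
    len      : ℕ
    ν        : Vec (Fin size) len
    H        : List (Fin size × Fin size)   -- (b , c) is the arrow b → c
    distinct : Vecᵁ.Unique ν
    covers   : ∀ i → i ∈ᵛ ν ⊎ Any (λ (b , c) → i ≡ b ⊎ i ≡ c) H

Increasing : ∀ {n m} → Vec (Fin n) m → Set
Increasing = Vecᴾ.AllPairs _<_

module _ (p : ArrowPattern) {n : ℕ} (π : Word n) where
  open ArrowPattern p

  Occurrence : Vec (Fin n) size → Vec (Fin n) len → Set
  Occurrence x t =
    Increasing x ×
    Increasing t ×
    Vec.map (lookup π) t ≡ Vec.map (lookup x) ν ×
    All (λ (b , c) → hat π (lookup x b) ≡ lookup x c) H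

  Contains : Set
  Contains = ∃ λ x → ∃ λ t → Occurrence x t

  Avoids : Set
  Avoids = ¬ Contains

  contains? : Dec Contains
  contains? = ∃-vec? λ x → ∃-vec? λ t →
    Vecᴾ.allPairs? _<?_ x ×-dec
    Vecᴾ.allPairs? _<?_ t ×-dec
    ≡-dec _≟_ (Vec.map (lookup π) t) (Vec.map (lookup x) ν) ×-dec
    All.all? (λ (b , c) → hat π (lookup x b) ≟ lookup x c) H

  avoids? : Dec Avoids
  avoids? = ¬? contains?

avoiders : ∀ n → ArrowPattern → List (Word n)
avoiders n p = filter (avoids? p) (permutations n)

⟨31∶3→2⟩ : ArrowPattern
⟨31∶3→2⟩ = record
  { size     = 3
  ; len      = 2
  ; ν        = 2F ∷ 0F ∷ []
  ; H        = [ (2F , 1F) ]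
  ; distinct = ((λ ()) Vecᴬ.∷ Vecᴬ.[]) Vecᴾ.∷ Vecᴬ.[] Vecᴾ.∷ Vecᴾ.[]
  ; covers   = λ where
      0F → inj₁ (Vecᴱ.there (Vecᴱ.here refl))
      1F → inj₂ (here (inj₂ refl))
      2F → inj₁ (Vecᴱ.here refl)
  }

------------------------------------------------------------------------
-- Set partitions and Bell numbers

subsets : ∀ n → List (Subset n)
subsets = vecs (inside ∷ outside ∷ [])

-- subsets n lists every subset once, so its sublists represent every set of
-- subsets of [n] exactly once.
families : ∀ n → List (List (Subset n))
families n = sublists (subsets n)

IsSetPartition : ∀ {n} → List (Subset n) → Set
IsSetPartition P =
  All Nonempty P ×
  AllPairs (λ p q → Empty (p ∩ q)) P ×
  (∀ i → Any (i ∈ˢ_) P)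

isSetPartition? : ∀ {n} → Decidable (IsSetPartition {n})
isSetPartition? P =
  All.all? nonempty? P ×-dec
  AllPairs.allPairs? (λ p q → ¬? (nonempty? (p ∩ q))) P ×-dec
  all? (λ i → Any.any? (i ∈ˢ?_) P)

setPartitions : ∀ n → List (List (Subset n))
setPartitions n = filter isSetPartition? (families n)

bell : ℕ → ℕ
bell n = length (setPartitions n)

{-# OPTIONS --safe #-}

-- The entry of π following x is smaller than x exactly when π̂ x < x, and then
-- it equals π̂ x, because a left-to-right maximum M exceeds the entry before it
-- and the last entry of its cycle is sent to M.  So π avoids (31; 3→2) iff it
-- avoids the vincular pattern 32-1, i.e. iff every descent bottom is a
-- right-to-left minimum.  Cutting such a word after each of its right-to-left
-- minima gives (possibly empty) increasing runs, each followed by a smaller entry m; rotating m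
-- to the front turns these into the blocks of a set partition, listed by
-- increasing minima, and the word is recovered from them.

module Submission where

open import Defs
open import Data.Nat.Base using (ℕ; _≥_; zero; suc; z<s; s<s; s<s⁻¹)
open import Data.List.Base using (length)
open import Relation.Binary.PropositionalEquality using (_≡_)

open import Data.Bool.Base using (if_then_else_)
open import Data.Fin.Base using (Fin; zero; suc; _<_; _≤_)
open import Data.Fin.Properties using (_≟_; _<?_; <-irrefl; <-asym; <-trans; <-cmp; injective⇒≤)
open import Data.Fin.Subset using (Subset; inside; outside; Nonempty; Empty; _∩_; ⊥; ⁅_⁆; _∪_)
  renaming (_∈_ to _∈ˢ_)
open import Data.Fin.Subset.Properties
  using (x∈⁅x⁆; x∈⁅y⁆⇒x≡y; ∉⊥; x∈p∪q⁺; x∈p∪q⁻; x∈p∩q⁺; x∈p∩q⁻)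
  renaming (_∈?_ to _∈ˢ?_; ⊆-antisym to ⊆ˢ-antisym)
open import Data.List.Base using (List; []; _∷_; _++_; concat; map; foldr; filter; allFin)
open import Data.List.Membership.Propositional using (_∈_; _∉_)
open import Data.List.Membership.Propositional.Properties
  using (∈-++⁺ˡ; ∈-++⁺ʳ; ∈-++⁻; ∈-concat⁺; ∈-concat⁻; ∈-concat⁺′; ∈-concat⁻′; ∈-filter⁺; ∈-filter⁻; ∈-map⁺; ∈-map⁻; ∈-allFin)
open import Data.List.Membership.Propositional.Properties.WithK using (unique∧set⇒bag)
open import Data.List.Properties using (foldr-++; length-tabulate; length-map)
open import Data.List.Relation.Binary.BagAndSetEquality using (∼bag⇒↭)
open import Data.List.Relation.Binary.Permutation.Propositional
  using (_↭_; ↭-refl; ↭-sym; ↭-trans; ↭-prep; ↭⇒↭ₛ)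
open import Data.List.Relation.Binary.Permutation.Propositional.Properties
  using (shift; ++⁺ˡ; ↭-length; ∈-resp-↭)
import Data.List.Relation.Binary.Permutation.Setoid.Properties as Permutationₛ
open import Data.List.Relation.Binary.Sublist.Propositional as Sublist
  using (_⊆_; []; _∷_; _∷ʳ_; ⊆-antisym)
open import Data.List.Relation.Unary.All as All using (All; []; _∷_)
import Data.List.Relation.Unary.All.Properties as Allₚ
open import Data.List.Relation.Unary.AllPairs as AllPairs using (AllPairs; []; _∷_)
import Data.List.Relation.Unary.AllPairs.Properties as AllPairsₚ
open import Data.List.Relation.Unary.Any as Any using (Any; here; there)
import Data.List.Relation.Unary.Any.Properties as Anyₚ
open import Data.List.Relation.Unary.Unique.Propositional using (Unique)
import Data.List.Relation.Unary.Unique.Propositional.Properties as Uniqueₚ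
import Data.Nat.Properties as ℕ
open import Data.Product.Base using (_×_; _,_; ∃; ∃₂; proj₁; proj₂)
open import Data.Sum.Base using (_⊎_; inj₁; inj₂)
open import Data.Vec.Base as Vec using (Vec; []; _∷_; lookup; toList)
open import Data.Vec.Membership.Propositional.Properties using (∈-lookup; ∈-toList⁺; ∈-toList⁻)
open import Data.Vec.Properties using (∷-injective; toList∘fromList; toList-injective; cast-is-id)
import Data.Vec.Relation.Unary.All as Vecᴬ
import Data.Vec.Relation.Unary.All.Properties as Vecᴬₚ
import Data.Vec.Relation.Unary.AllPairs as Vecᴾ
import Data.Vec.Relation.Unary.Any as Vecᴱ
import Data.Vec.Relation.Unary.Any.Properties as Vecᴱₚ
import Data.Vec.Relation.Unary.Unique.Propositional as Vecᵁ
import Data.Vec.Relation.Unary.Unique.Propositional.Properties as Vecᵁₚ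
open import Function.Base using (_∘_; id)
open import Function.Bundles using (mk⇔)
open import Level using (0ℓ)
open import Relation.Binary.Core using (Rel)
open import Relation.Binary.Definitions using (Asymmetric; tri<; tri≈; tri>)
open import Relation.Binary.PropositionalEquality using (_≢_; refl; sym; trans; cong; cong₂; subst; setoid)
open import Relation.Nullary using (¬_; yes; no; does; contradiction)
open import Relation.Nullary.Decidable using (dec-true; dec-false; ¬?)

private
  variable
    A B : Set
    n   : ℕ

-- Lists without repetition and sorted lists

++⁻ : {R : Rel A 0ℓ} (xs : List A) {ys : List A} → AllPairs R (xs ++ ys) →
      AllPairs R xs × AllPairs R ys × All (λ x → All (R x) ys) xs
++⁻ []       ps       = [] , ps , []
++⁻ (x ∷ xs) (p ∷ ps) with ++⁻ xs ps
... | rxs , rys , rxys = Allₚ.++⁻ˡ xs p ∷ rxs , rys , Allₚ.++⁻ʳ xs p ∷ rxys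

Unique-∉ : {x : A} {xs : List A} → Unique (x ∷ xs) → x ∉ xs
Unique-∉ = Uniqueₚ.Unique[x∷xs]⇒x∉xs

Unique-++-∉ : (xs : List A) {ys : List A} {x : A} → Unique (xs ++ ys) → x ∈ xs → x ∉ ys
Unique-++-∉ xs u x∈xs x∈ys with ++⁻ xs u
... | _ , _ , xs≢ys = All.lookup (All.lookup xs≢ys x∈xs) x∈ys refl

Unique-resp-↭ : {xs ys : List A} → xs ↭ ys → Unique xs → Unique ys
Unique-resp-↭ xs↭ys = Permutationₛ.Unique-resp-↭ (setoid _) (↭⇒↭ₛ xs↭ys)

Unique-map⁺ : {f : A → B} {xs : List A} → (∀ {x y} → x ∈ xs → y ∈ xs → f x ≡ f y → x ≡ y) →
              Unique xs → Unique (map f xs)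
Unique-map⁺ inj []       = []
Unique-map⁺ inj (p ∷ ps) =
  Allₚ.map⁺ (All.tabulate λ y∈ fx≡fy → All.lookup p y∈ (inj (here refl) (there y∈) fx≡fy))
  ∷ Unique-map⁺ (λ x∈ y∈ → inj (there x∈) (there y∈)) ps

unique-length : {xs ys : List A} → Unique xs → Unique ys →
                (∀ {x} → x ∈ xs → x ∈ ys) → (∀ {x} → x ∈ ys → x ∈ xs) → length xs ≡ length ys
unique-length uxs uys to from = ↭-length (∼bag⇒↭ (unique∧set⇒bag uxs uys (mk⇔ to from)))

AllPairs-⊆ : {R : Rel A 0ℓ} {xs ys : List A} → xs ⊆ ys → AllPairs R ys → AllPairs R xs
AllPairs-⊆ []          []       = []
AllPairs-⊆ (y ∷ʳ s)    (_ ∷ ps) = AllPairs-⊆ s ps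
AllPairs-⊆ (refl ∷ s)  (p ∷ ps) = All.tabulate (All.lookup p ∘ Sublist.lookup s) ∷ AllPairs-⊆ s ps

-- If `x` is not the head `y`, then `y` is related to `x`, and `x` to every entry of `xs`. By
-- asymmetry `y` is not in `xs`, so it can be skipped. Used in both directions this identifies
-- sorted lists with the same members.
sorted-⊆ : {R : Rel A 0ℓ} → Asymmetric R → {xs ys : List A} →
           AllPairs R xs → AllPairs R ys → (∀ {x} → x ∈ xs → x ∈ ys) → xs ⊆ ys
sorted-⊆ asym {[]}     {[]}     _ _ _   = []
sorted-⊆ asym {[]}     {y ∷ ys} _ (_ ∷ rys) _ = y ∷ʳ sorted-⊆ asym [] rys λ ()
sorted-⊆ asym {x ∷ xs} {[]}     _ _ sub with () ← sub (here refl)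
sorted-⊆ {R = R} asym {x ∷ xs} {y ∷ ys} (rx ∷ rxs) (ry ∷ rys) sub with sub (here refl)
... | here refl = refl ∷ sorted-⊆ asym rxs rys sub′
  where
  sub′ : ∀ {z} → z ∈ xs → z ∈ ys
  sub′ z∈xs with sub (there z∈xs)
  ... | here refl  = contradiction (All.lookup rx z∈xs) (λ r → asym r r)
  ... | there z∈ys = z∈ys
... | there x∈ys = y ∷ʳ sorted-⊆ asym (rx ∷ rxs) rys sub′
  where
  sub′ : ∀ {z} → z ∈ x ∷ xs → z ∈ ys
  sub′ (here refl)  = x∈ys
  sub′ (there z∈xs) with sub (there z∈xs)
  ... | here refl  = contradiction (All.lookup ry x∈ys) (asym (All.lookup rx z∈xs))
  ... | there z∈ys = z∈ys

-- The permutation π̂ along the word π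

data Adjacent {A : Set} (x y : A) : List A → Set where
  here  : ∀ {w} → Adjacent x y (x ∷ y ∷ w)
  there : ∀ {z w} → Adjacent x y w → Adjacent x y (z ∷ w)

Adjacent-∈ˡ : {x y : A} {w : List A} → Adjacent x y w → x ∈ w
Adjacent-∈ˡ here      = here refl
Adjacent-∈ˡ (there a) = there (Adjacent-∈ˡ a)

Adjacent-∈ʳ : {x y : A} {w : List A} → Adjacent x y w → y ∈ w
Adjacent-∈ʳ here      = there (here refl)
Adjacent-∈ʳ (there a) = there (Adjacent-∈ʳ a)

Adjacent-++⁺ˡ : {x y : A} {v w : List A} → Adjacent x y v → Adjacent x y (v ++ w)
Adjacent-++⁺ˡ here      = here
Adjacent-++⁺ˡ (there a) = there (Adjacent-++⁺ˡ a)

Adjacent-++⁺ʳ : {x y : A} (v : List A) {w : List A} → Adjacent x y w → Adjacent x y (v ++ w)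
Adjacent-++⁺ʳ []      a = a
Adjacent-++⁺ʳ (_ ∷ v) a = there (Adjacent-++⁺ʳ v a)

-- The traversal local to `cycle`, with its captured values as arguments: `h` opens the whole cycle
-- and is the image of its last entry, while `c` is the entry now compared with `x`.
next : Fin n → Fin n → Fin n → List (Fin n) → Fin n
next h x c []       = if does (x ≟ c) then h else x
next h x c (d ∷ ds) = if does (x ≟ c) then d else next h x d ds

-- The function  go  local to  cycle  has no name here; the underscore is
-- solved to it by the use of  go≡next  in  cycle≡next .
mutual
  cycle≡next : (h x : Fin n) (cs : List (Fin n)) → cycle (h ∷ cs) x ≡ next h x h cs
  cycle≡next h x []       = refl
  cycle≡next h x (d ∷ ds) = cong (if does (x ≟ h) then d else_) (go≡next h x d ds)

  go≡next : (h x c : Fin n) (ds : List (Fin n)) → _ ≡ next h x c ds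
  go≡next h x c []       = refl
  go≡next h x c (d ∷ ds) = cong (if does (x ≟ c) then d else_) (go≡next h x d ds)

next-∉ : (h x c : Fin n) (ds : List (Fin n)) → x ∉ c ∷ ds → next h x c ds ≡ x
next-∉ h x c []       x∉ rewrite dec-false (x ≟ c) (x∉ ∘ here) = refl
next-∉ h x c (d ∷ ds) x∉ rewrite dec-false (x ≟ c) (x∉ ∘ here) = next-∉ h x d ds (x∉ ∘ there)

next-∈ : (h x c : Fin n) (ds : List (Fin n)) → x ∈ c ∷ ds →
         Adjacent x (next h x c ds) (c ∷ ds) ⊎ next h x c ds ≡ h
next-∈ h x c []       (here x≡c) rewrite dec-true (x ≟ c) x≡c = inj₂ refl
next-∈ h x c (d ∷ ds) x∈         with x ≟ c
next-∈ h x c (d ∷ ds) x∈         | yes refl = inj₁ here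
next-∈ h x c (d ∷ ds) (here x≡c) | no x≢c   = contradiction x≡c x≢c
next-∈ h x c (d ∷ ds) (there x∈) | no _     with next-∈ h x d ds x∈
... | inj₁ a  = inj₁ (there a)
... | inj₂ ≡h = inj₂ ≡h

next-adjacent : {x y : Fin n} (h c : Fin n) (ds : List (Fin n)) → Unique (c ∷ ds) →
                Adjacent x y (c ∷ ds) → next h x c ds ≡ y
next-adjacent h c (d ∷ ds) u       here rewrite dec-true (c ≟ c) refl = refl
next-adjacent {x = x} h c (d ∷ ds) (c≢ds ∷ u) (there a)
  rewrite dec-false (x ≟ c) (λ x≡c → All.lookup c≢ds (Adjacent-∈ˡ a) (sym x≡c)) =
  next-adjacent h d ds u a

cycle-∉ : {x : Fin n} (c : List (Fin n)) → x ∉ c → cycle c x ≡ x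
cycle-∉         []       _  = refl
cycle-∉ {x = x} (h ∷ cs) x∉ = trans (cycle≡next h x cs) (next-∉ h x h cs x∉)

cycle-adjacent : {x y : Fin n} (c : List (Fin n)) → Unique c → Adjacent x y c → cycle c x ≡ y
cycle-adjacent {x = x} (h ∷ cs) u a = trans (cycle≡next h x cs) (next-adjacent h h cs u a)

data LedByMax {n} : List (Fin n) → Set where
  led : ∀ {M c} → All (_≤ M) c → LedByMax (M ∷ c)

-- The only arrow of a cycle that does not join neighbours is the closing one. It ends at the
-- leading maximum `M`, so it cannot go down.
cycle-led : {x : Fin n} {c : List (Fin n)} → LedByMax c → x ∈ c →
            cycle c x ∈ c × (Adjacent x (cycle c x) c ⊎ x ≤ cycle c x)
cycle-led {x = x} (led {M} {c} c≤M) x∈ rewrite cycle≡next M x c with next-∈ M x M c x∈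
... | inj₁ a = Adjacent-∈ʳ a , inj₁ a
... | inj₂ eq rewrite eq = here refl , inj₂ (All.lookup (ℕ.≤-refl ∷ c≤M) x∈)

-- By disjointness at most one factor of the product moves a given point.
product : List (List (Fin n)) → Fin n → Fin n
product cs x = foldr cycle x cs

product-∉ : {x : Fin n} (cs : List (List (Fin n))) → x ∉ concat cs → product cs x ≡ x
product-∉ []       _  = refl
product-∉ (c ∷ cs) x∉ rewrite product-∉ cs (x∉ ∘ ∈-++⁺ʳ c) = cycle-∉ c (x∉ ∘ ∈-++⁺ˡ)

product-adjacent : {x y : Fin n} (cs : List (List (Fin n))) → Unique (concat cs) →
                   Any (Adjacent x y) cs → product cs x ≡ y
product-adjacent (c ∷ cs) u (here a)
  rewrite product-∉ cs (Unique-++-∉ c u (Adjacent-∈ˡ a)) = cycle-adjacent c (proj₁ (++⁻ c u)) a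
-- `foldr` applies the later cycles first: they have already sent `x` to `y`. As `y` lies in one of
-- them, the disjoint cycle `c` fixes it.
product-adjacent (c ∷ cs) u (there a)
  rewrite product-adjacent cs (proj₁ (proj₂ (++⁻ c u))) a =
  cycle-∉ c λ y∈c → Unique-++-∉ c u y∈c (∈-concat⁺ (Any.map Adjacent-∈ʳ a))

-- The first conclusion carries the induction: an image that stays inside the later cycles lies
-- outside `c`, so applying `c` afterwards does not move it.
product-led : {x : Fin n} {cs : List (List (Fin n))} → All LedByMax cs → Unique (concat cs) →
              x ∈ concat cs →
              product cs x ∈ concat cs × (Adjacent x (product cs x) (concat cs) ⊎ x ≤ product cs x)
product-led {cs = c ∷ cs} (l ∷ ls) u x∈ with ∈-++⁻ c x∈
... | inj₁ x∈c rewrite product-∉ cs (Unique-++-∉ c u x∈c) with cycle-led l x∈c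
...   | y∈c , inj₁ a   = ∈-++⁺ˡ y∈c , inj₁ (Adjacent-++⁺ˡ a)
...   | y∈c , inj₂ x≤y = ∈-++⁺ˡ y∈c , inj₂ x≤y
product-led {cs = c ∷ cs} (l ∷ ls) u x∈ | inj₂ x∈cs with product-led ls (proj₁ (proj₂ (++⁻ c u))) x∈cs
... | y∈cs , p rewrite cycle-∉ c (λ y∈c → Unique-++-∉ c u y∈c y∈cs) with p
...   | inj₁ a   = ∈-++⁺ʳ c y∈cs , inj₁ (Adjacent-++⁺ʳ c a)
...   | inj₂ x≤y = ∈-++⁺ʳ c y∈cs , inj₂ x≤y

concat-run : (M : Fin n) (w : List (Fin n)) → proj₁ (run M w) ++ concat (proj₂ (run M w)) ≡ w
concat-run M []      = refl
concat-run M (b ∷ w) with M <? b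
... | yes _ = cong (b ∷_) (concat-run b w)
... | no  _ = cong (b ∷_) (concat-run M w)

concat-cycles : (w : List (Fin n)) → concat (cycles w) ≡ w
concat-cycles []      = refl
concat-cycles (a ∷ w) = cong (a ∷_) (concat-run a w)

run-led : (M : Fin n) (w : List (Fin n)) → All (_≤ M) (proj₁ (run M w)) × All LedByMax (proj₂ (run M w))
run-led M []      = [] , []
run-led M (b ∷ w) with M <? b
... | yes _   = let c≤b , ls = run-led b w in [] , led c≤b ∷ ls
... | no  M≮b = let c≤M , ls = run-led M w in ℕ.≮⇒≥ M≮b ∷ c≤M , ls

cycles-led : (w : List (Fin n)) → All LedByMax (cycles w)
cycles-led []      = []
cycles-led (a ∷ w) = let c≤a , ls = run-led a w in led c≤a ∷ ls

-- A left-to-right maximum exceeds the entry before it, so no descent is cut.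
run-descent : {x y : Fin n} (M p : Fin n) (w : List (Fin n)) → p ≤ M → y < x → Adjacent x y (p ∷ w) →
              Adjacent x y (p ∷ proj₁ (run M w)) ⊎ Any (Adjacent x y) (proj₂ (run M w))
run-descent M p []      p≤M y<x (there ())
run-descent M p (b ∷ w) p≤M y<x a with M <? b
run-descent M p (b ∷ w) p≤M y<x here      | yes M<b =
  contradiction (ℕ.<-trans (ℕ.<-≤-trans y<x p≤M) M<b) (<-irrefl refl)
run-descent M p (b ∷ w) p≤M y<x (there a) | yes M<b with run-descent b b w ℕ.≤-refl y<x a
... | inj₁ a′ = inj₂ (here a′)
... | inj₂ as = inj₂ (there as)
run-descent M p (b ∷ w) p≤M y<x here      | no M≮b = inj₁ here
run-descent M p (b ∷ w) p≤M y<x (there a) | no M≮b with run-descent M b w (ℕ.≮⇒≥ M≮b) y<x a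
... | inj₁ a′ = inj₁ (there a′)
... | inj₂ as = inj₂ as

cycles-descent : {x y : Fin n} (w : List (Fin n)) → y < x → Adjacent x y w → Any (Adjacent x y) (cycles w)
cycles-descent (a ∷ w) y<x adj with run-descent a a w ℕ.≤-refl y<x adj
... | inj₁ adj′ = here adj′
... | inj₂ adjs = there adjs

hat-descent⁺ : {x y : Fin n} (π : Word n) → Unique (toList π) →
               Adjacent x y (toList π) → y < x → hat π x ≡ y
hat-descent⁺ π u a y<x =
  product-adjacent (cycles (toList π)) (subst Unique (sym (concat-cycles (toList π))) u)
    (cycles-descent (toList π) y<x a)

-- `hat π` unfolds to the product of `cycles (toList π)`, and the strict drop rules out the closing
-- arrow of a cycle.
hat-descent⁻ : {x : Fin n} (π : Word n) → Unique (toList π) →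
               x ∈ toList π → hat π x < x → Adjacent x (hat π x) (toList π)
hat-descent⁻ {x = x} π u x∈ y<x
  with product-led (cycles-led (toList π)) (subst Unique (sym eq) u) (subst (x ∈_) (sym eq) x∈)
  where eq = concat-cycles (toList π)
... | _ , inj₁ a   = subst (Adjacent x (hat π x)) (concat-cycles (toList π)) a
... | _ , inj₂ x≤y = contradiction y<x (ℕ.≤⇒≯ x≤y)

-- The vincular pattern 32-1

data Vincular {A : Set} (b c d : A) : List A → Set where
  here  : ∀ {w} → d ∈ w → Vincular b c d (b ∷ c ∷ w)
  there : ∀ {a w} → Vincular b c d w → Vincular b c d (a ∷ w)

Avoids32-1 : List (Fin n) → Set
Avoids32-1 w = ∀ {b c d} → Vincular b c d w → c < b → ¬ d < c

Vincular⇒Adjacent : {b c d : A} {w : List A} → Vincular b c d w → Adjacent b c w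
Vincular⇒Adjacent (here _)  = here
Vincular⇒Adjacent (there v) = there (Vincular⇒Adjacent v)

lookup-∈-toList : ∀ {m} (v : Vec A m) i → lookup v i ∈ toList v
lookup-∈-toList v i = ∈-toList⁺ (∈-lookup i v)

-- An occurrence of the arrow pattern only says that `d` comes somewhere after `b`. Since `b` occurs
-- once, its position is that of the adjacent pair, and since `d` is not `c`, it comes after the
-- pair.
vincular⁺ : ∀ {m} {b c d : A} (v : Vec A m) {i j : Fin m} → i < j → lookup v i ≡ b → lookup v j ≡ d →
            Unique (toList v) → Adjacent b c (toList v) → d ≢ c → Vincular b c d (toList v)
vincular⁺ (x ∷ y ∷ v) {zero}  {suc zero}    _ refl refl u here d≢c = contradiction refl d≢c
vincular⁺ (x ∷ y ∷ v) {zero}  {suc (suc j)} _ refl refl u here d≢c = here (lookup-∈-toList v j)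
vincular⁺ (x ∷ v) {zero} {suc j} _ refl refl u (there a) d≢c =
  contradiction (Adjacent-∈ˡ a) (Unique-∉ u)
vincular⁺ (x ∷ y ∷ v) {suc i} {suc j} _ refl refl u here d≢c =
  contradiction (lookup-∈-toList (y ∷ v) i) (Unique-∉ u)
vincular⁺ (x ∷ v) {suc i} {suc j} i<j eq eq′ (_ ∷ u) (there a) d≢c =
  there (vincular⁺ v (s<s⁻¹ i<j) eq eq′ u a d≢c)

vincular⁻ : ∀ {m} {b c d : A} (v : Vec A m) → Vincular b c d (toList v) →
            ∃₂ λ i j → i < j × lookup v i ≡ b × lookup v j ≡ d
vincular⁻ (b ∷ c ∷ v) (here d∈) =
  zero , suc (suc (Vecᴱ.index (∈-toList⁻ d∈))) , z<s , refl , sym (Vecᴱₚ.lookup-index (∈-toList⁻ d∈))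
vincular⁻ (a ∷ v) (there p) with vincular⁻ v p
... | i , j , i<j , eq , eq′ = suc i , suc j , s<s i<j , eq , eq′

avoids⇒avoids32-1 : (π : Word n) → Unique (toList π) → Avoids ⟨31∶3→2⟩ π → Avoids32-1 (toList π)
avoids⇒avoids32-1 π u av {b} {c} {d} v c<b d<c with vincular⁻ π v
... | i , j , i<j , refl , refl = av
  -- The chosen values are `x₁ = d`, `x₂ = c`, `x₃ = b`: the word 31 reads `b` then `d`, and the
  -- arrow 3→2 says that `b` is sent to `c`.
  ( d ∷ c ∷ b ∷ [] , i ∷ j ∷ []
  , ((d<c Vecᴬ.∷ <-trans d<c c<b Vecᴬ.∷ Vecᴬ.[]) Vecᴾ.∷ (c<b Vecᴬ.∷ Vecᴬ.[]) Vecᴾ.∷ Vecᴬ.[] Vecᴾ.∷ Vecᴾ.[])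
  , ((i<j Vecᴬ.∷ Vecᴬ.[]) Vecᴾ.∷ Vecᴬ.[] Vecᴾ.∷ Vecᴾ.[])
  , refl
  , hat-descent⁺ π u (Vincular⇒Adjacent v) c<b ∷ [] )

avoids32-1⇒avoids : (π : Word n) → Unique (toList π) → Avoids32-1 (toList π) → Avoids ⟨31∶3→2⟩ π
avoids32-1⇒avoids π u av
  ( d ∷ c ∷ b ∷ [] , i ∷ j ∷ []
  , ((d<c Vecᴬ.∷ _) Vecᴾ.∷ (c<b Vecᴬ.∷ _) Vecᴾ.∷ _)
  , ((i<j Vecᴬ.∷ _) Vecᴾ.∷ _)
  , eq , ĉ ∷ [] ) with ∷-injective eq
... | πi≡b , eq′ with ∷-injective eq′
... | πj≡d , _ = av (vincular⁺ π i<j πi≡b πj≡d u adj (λ d≡c → <-irrefl d≡c d<c)) c<b d<c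
  where
  adj : Adjacent b c (toList π)
  -- The arrow gives `hat π b ≡ c` with `c < b`, a strict drop, so `c` stands right after `b`.
  adj = subst (λ y → Adjacent b y (toList π)) ĉ
    (hat-descent⁻ π u (subst (_∈ toList π) πi≡b (lookup-∈-toList π i)) (subst (_< b) (sym ĉ) c<b))

-- Words and block decompositions

word : List (List A) → List A
word []             = []
word ([] ∷ L)       = word L
word ((m ∷ ws) ∷ L) = ws ++ m ∷ word L

-- Updates the blocks when `a` is put in front of the word. For valid blocks `m` is the least entry
-- of the word, so `a < m` makes `a` a new right-to-left minimum with a block of its own; otherwise
-- `a` joins the front of the run that ends before `m`.
insert : Fin n → List (List (Fin n)) → List (List (Fin n))
insert a []             = (a ∷ []) ∷ []
insert a ([] ∷ L)       = (a ∷ []) ∷ L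
insert a ((m ∷ ws) ∷ L) with a <? m
... | yes _ = (a ∷ []) ∷ (m ∷ ws) ∷ L
... | no  _ = (m ∷ a ∷ ws) ∷ L

blocks : List (Fin n) → List (List (Fin n))
blocks = foldr insert []

-- The blocks of a partition by increasing minima, each block m ∷ ws with its
-- minimum first, whereas  word  puts m after ws.
data Valid {n} : List (List (Fin n)) → Set where
  []    : Valid []
  block : ∀ {m ws L} → AllPairs _<_ (m ∷ ws) → All (m <_) (concat L) → Valid L → Valid ((m ∷ ws) ∷ L)

word-insert : (a : Fin n) (L : List (List (Fin n))) → word (insert a L) ≡ a ∷ word L
word-insert a []             = refl
word-insert a ([] ∷ L)       = refl
word-insert a ((m ∷ ws) ∷ L) with a <? m
... | yes _ = refl
... | no  _ = refl

word-blocks : (w : List (Fin n)) → word (blocks w) ≡ w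
word-blocks []      = refl
word-blocks (a ∷ w) = trans (word-insert a (blocks w)) (cong (a ∷_) (word-blocks w))

word-↭ : (L : List (List A)) → word L ↭ concat L
word-↭ []             = ↭-refl
word-↭ ([] ∷ L)       = word-↭ L
word-↭ ((m ∷ ws) ∷ L) = ↭-trans (shift m ws (word L)) (↭-prep m (++⁺ˡ ws (word-↭ L)))

insert-min : {m : Fin n} {L : List (List (Fin n))} → All (m <_) (concat L) → Valid L →
             insert m L ≡ (m ∷ []) ∷ L
insert-min         _            []            = refl
insert-min {m = m} (m<m′ ∷ _) (block {m′} _ _ _) with m <? m′
... | yes _   = refl
... | no m≮m′ = contradiction m<m′ m≮m′

insert-larger : {m : Fin n} {ws : List (Fin n)} (L : List (List (Fin n))) → All (m <_) ws →
                foldr insert ((m ∷ []) ∷ L) ws ≡ (m ∷ ws) ∷ L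
insert-larger L []          = refl
insert-larger {m = m} {ws = a ∷ ws} L (m<a ∷ m<ws) rewrite insert-larger L m<ws with a <? m
... | yes a<m = contradiction m<a (<-asym a<m)
... | no  _   = refl

-- The fold reads the word from the right: it rebuilds `L`, then `m`, smaller than everything in
-- `L`, opens a block, and then the entries of `ws`, all above `m`, enter that block one by one.
blocks-word : {L : List (List (Fin n))} → Valid L → blocks (word L) ≡ L
blocks-word []                                                = refl
blocks-word (block {m} {ws} {L} (m<ws ∷ _) m<L v)
  rewrite foldr-++ insert [] ws (m ∷ word L) | blocks-word v | insert-min m<L v = insert-larger L m<ws

-- Avoidance matters when `a` joins the block of `m`: if the next entry `b` of the run were below
-- `a`, then `a b` together with the later `m < b` would form a 32-1. Hence the run stays
-- increasing.
insert-valid : {a : Fin n} {L : List (List (Fin n))} → Valid L → a ∉ word L → Avoids32-1 (a ∷ word L) →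
               Valid (insert a L)
insert-valid []  _  _  = block ([] ∷ []) [] []
insert-valid {a = a} (block {m} {ws} {L} (m<ws ∷ sws) m<L v) a∉ av with a <? m
... | yes a<m = block ([] ∷ []) (a<m ∷ Allₚ.++⁺ (All.map (<-trans a<m) m<ws) (All.map (<-trans a<m) m<L))
                      (block (m<ws ∷ sws) m<L v)
... | no  a≮m = block ((m<a ∷ m<ws) ∷ a<ws ws m<ws sws a∉ av ∷ sws) m<L v
  where
  m<a : m < a
  m<a with <-cmp m a
  ... | tri< m<a _ _  = m<a
  ... | tri≈ _ refl _ = contradiction (∈-++⁺ʳ ws (here refl)) a∉
  ... | tri> _ _ a<m  = contradiction a<m a≮m

  a<ws : ∀ ws → All (m <_) ws → AllPairs _<_ ws → a ∉ ws ++ m ∷ word L →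
         Avoids32-1 (a ∷ ws ++ m ∷ word L) → All (a <_) ws
  a<ws []       _          _          _  _  = []
  a<ws (b ∷ ws) (m<b ∷ _) (b<ws ∷ _) a∉ av with <-cmp a b
  ... | tri< a<b _ _  = a<b ∷ All.map (<-trans a<b) b<ws
  ... | tri≈ _ refl _ = contradiction (here refl) a∉
  ... | tri> _ _ b<a  = contradiction m<b (av (here (∈-++⁺ʳ ws (here refl))) b<a)

blocks-valid : (w : List (Fin n)) → Unique w → Avoids32-1 w → Valid (blocks w)
blocks-valid []      _           _  = []
blocks-valid (a ∷ w) u@(_ ∷ u′) av = insert-valid (blocks-valid w u′ (av ∘ there))
  (subst (a ∉_) (sym (word-blocks w)) (Unique-∉ u))
  (subst (Avoids32-1 ∘ (a ∷_)) (sym (word-blocks w)) av)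

-- There is no descent inside `ws` or from `m` into `w`. A descent onto `m` is harmless because all
-- of `w` exceeds `m`, and the remaining descents lie in `w`.
avoids-++ : ∀ {m : Fin n} ws {w} → AllPairs _<_ ws → All (m <_) w → Avoids32-1 w →
            Avoids32-1 (ws ++ m ∷ w)
avoids-++ []           _                  (m<c ∷ _) av (here _)   c<m _   = <-asym c<m m<c
avoids-++ []           _                  m<w       av (there v)  = av v
avoids-++ (a ∷ [])     _                  m<w       av (here d∈)  _ d<m = <-asym d<m (All.lookup m<w d∈)
avoids-++ (a ∷ b ∷ ws) ((a<b ∷ _) ∷ _)    m<w       av (here _)   b<a _ = <-asym a<b b<a
avoids-++ (a ∷ ws)     (_ ∷ sws)          m<w       av (there v)  = avoids-++ ws sws m<w av v

word-avoids : {L : List (List (Fin n))} → Valid L → Avoids32-1 (word L)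
word-avoids (block {ws = ws} {L} (_ ∷ sws) m<L v) =
  avoids-++ ws sws (All.tabulate (All.lookup m<L ∘ ∈-resp-↭ (word-↭ L))) (word-avoids v)

-- Subsets of [n] as sorted lists

elements : Subset n → List (Fin n)
elements p = filter (_∈ˢ? p) (allFin _)

elements-sorted : (p : Subset n) → AllPairs _<_ (elements p)
elements-sorted p = AllPairsₚ.filter⁺ (_∈ˢ? p) (AllPairsₚ.tabulate⁺-< id)

∈-elements⁺ : {i : Fin n} (p : Subset n) → i ∈ˢ p → i ∈ elements p
∈-elements⁺ p = ∈-filter⁺ (_∈ˢ? p) (∈-allFin _)

∈-elements⁻ : {i : Fin n} (p : Subset n) → i ∈ elements p → i ∈ˢ p
∈-elements⁻ p i∈ = proj₂ (∈-filter⁻ (_∈ˢ? p) {xs = allFin _} i∈)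

subset : List (Fin n) → Subset n
subset = foldr (λ i p → ⁅ i ⁆ ∪ p) ⊥

∈-subset⁺ : {i : Fin n} {xs : List (Fin n)} → i ∈ xs → i ∈ˢ subset xs
∈-subset⁺ {i = i} (here refl) = x∈p∪q⁺ (inj₁ (x∈⁅x⁆ i))
∈-subset⁺         (there i∈)  = x∈p∪q⁺ (inj₂ (∈-subset⁺ i∈))

∈-subset⁻ : {i : Fin n} (xs : List (Fin n)) → i ∈ˢ subset xs → i ∈ xs
∈-subset⁻ []       i∈ = contradiction i∈ ∉⊥
∈-subset⁻ (x ∷ xs) i∈ with x∈p∪q⁻ ⁅ x ⁆ (subset xs) i∈
... | inj₁ i∈x  = here (x∈⁅y⁆⇒x≡y x i∈x)
... | inj₂ i∈xs = there (∈-subset⁻ xs i∈xs)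

subset-elements : (p : Subset n) → subset (elements p) ≡ p
subset-elements p = ⊆ˢ-antisym (∈-elements⁻ p ∘ ∈-subset⁻ (elements p)) (∈-subset⁺ ∘ ∈-elements⁺ p)

elements-subset : {xs : List (Fin n)} → AllPairs _<_ xs → elements (subset xs) ≡ xs
elements-subset {xs = xs} sxs = ⊆-antisym
  (sorted-⊆ <-asym (elements-sorted (subset xs)) sxs (∈-subset⁻ xs ∘ ∈-elements⁻ (subset xs)))
  (sorted-⊆ <-asym sxs (elements-sorted (subset xs)) (∈-elements⁺ (subset xs) ∘ ∈-subset⁺))

-- The order in which  subsets n  lists the subsets.  On disjoint nonempty
-- subsets it compares minima, so a set partition in  families n  has its blocks
-- listed by increasing minima.
data _≺_ : ∀ {n} → Subset n → Subset n → Set where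
  here  : {p q : Subset n} → (inside ∷ p) ≺ (outside ∷ q)
  there : ∀ {s} {p q : Subset n} → p ≺ q → (s ∷ p) ≺ (s ∷ q)

≺-asym : Asymmetric (_≺_ {n})
≺-asym (there p≺q) (there q≺p) = ≺-asym p≺q q≺p

-- cartesianProductWith leaves a trailing empty list.
subsets-sorted : ∀ n → AllPairs _≺_ (subsets n)
subsets-sorted zero    = [] ∷ []
subsets-sorted (suc n) = AllPairsₚ.++⁺ (cons inside) (AllPairsₚ.++⁺ (cons outside) [] (All.universal (λ _ → []) _))
  (Allₚ.map⁺ (All.universal (λ _ → Allₚ.++⁺ (Allₚ.map⁺ (All.universal (λ _ → here) _)) []) _))
  where
  cons : ∀ s → AllPairs _≺_ (map (s ∷_) (subsets n))
  cons s = AllPairsₚ.map⁺ (AllPairs.map there (subsets-sorted n))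

∈-subsets : (p : Subset n) → p ∈ subsets n
∈-subsets = ∈-vecs⁺ λ where
  inside  → here refl
  outside → there (here refl)

-- Up to coordinate `m` the set `q` has no element, so the first coordinate where `p` and `q` differ
-- is the first element of `p`.
min-≺ : {m : Fin n} {p q : Subset n} → m ∈ˢ p → (∀ {j} → j ∈ˢ q → m < j) → p ≺ q
min-≺ {p = inside ∷ p}  {inside ∷ q}  m∈ m<q with () ← m<q Vec.here
min-≺ {p = inside ∷ p}  {outside ∷ q} m∈ m<q = here
min-≺ {p = outside ∷ p} {inside ∷ q}  m∈ m<q with () ← m<q Vec.here
min-≺ {p = outside ∷ p} {outside ∷ q} (Vec.there m∈) m<q = there (min-≺ m∈ (s<s⁻¹ ∘ m<q ∘ Vec.there))

-- The witness `i` is the first coordinate where the sets differ. Before it they agree, hence by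
-- disjointness both are empty there, which forces `j` to come later.
≺-min : {j : Fin n} {p q : Subset n} → p ≺ q → Empty (p ∩ q) → j ∈ˢ q → ∃ λ i → i ∈ˢ p × i < j
≺-min here _ (Vec.there j∈) = zero , Vec.here , z<s
≺-min (there p≺q) p∩q=∅ Vec.here = contradiction (zero , Vec.here) p∩q=∅
≺-min (there p≺q) p∩q=∅ (Vec.there j∈)
  with i , i∈ , i<j ← ≺-min p≺q (λ (i , i∈) → p∩q=∅ (suc i , Vec.there i∈)) j∈
  = suc i , Vec.there i∈ , s<s i<j

-- The bijection

Vecᵁ⇒Unique : ∀ {m} {v : Vec A m} → Vecᵁ.Unique v → Unique (toList v)
Vecᵁ⇒Unique Vecᴾ.[]       = []
Vecᵁ⇒Unique (p Vecᴾ.∷ ps) = Vecᴬₚ.toList⁺ p ∷ Vecᵁ⇒Unique ps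

Unique⇒Vecᵁ : ∀ {m} (v : Vec A m) → Unique (toList v) → Vecᵁ.Unique v
Unique⇒Vecᵁ []      _        = Vecᴾ.[]
Unique⇒Vecᵁ (x ∷ v) (p ∷ ps) = Vecᴬₚ.toList⁻ p Vecᴾ.∷ Unique⇒Vecᵁ v ps

-- Pigeonhole: with a missing value `i` put in front, `π` would inject a set of size `suc n` into
-- `Fin n`.
unique-word-full : (π : Word n) → Vecᵁ.Unique π → ∀ i → i ∈ toList π
unique-word-full π u i with Any.any? (i ≟_) (toList π)
... | yes i∈π = i∈π
... | no  i∉π = contradiction (injective⇒≤ (Vecᵁₚ.lookup-injective i∷π! _ _)) ℕ.1+n≰n
  where
  i∷π! : Vecᵁ.Unique (i ∷ π)
  i∷π! = Vecᴬₚ.toList⁻ (Allₚ.¬Any⇒All¬ _ i∉π) Vecᴾ.∷ u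

vecOfLength : ∀ {m} (w : List A) → length w ≡ m → ∃ λ (v : Vec A m) → toList v ≡ w
vecOfLength w refl = Vec.fromList w , toList∘fromList w

toPartition : Word n → List (Subset n)
toPartition π = map subset (blocks (toList π))

fromPartition : List (Subset n) → List (Fin n)
fromPartition P = word (map elements P)

map-elements-subset : {L : List (List (Fin n))} → Valid L → map elements (map subset L) ≡ L
map-elements-subset []              = refl
map-elements-subset (block s _ v) = cong₂ _∷_ (elements-subset s) (map-elements-subset v)

fromPartition-toPartition : (π : Word n) → Valid (blocks (toList π)) → fromPartition (toPartition π) ≡ toList π
fromPartition-toPartition π v = trans (cong word (map-elements-subset v)) (word-blocks (toList π))

map-subset-elements : (P : List (Subset n)) → map subset (map elements P) ≡ P
map-subset-elements []      = refl
map-subset-elements (p ∷ P) = cong₂ _∷_ (subset-elements p) (map-subset-elements P)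

valid⇒nonempty : {L : List (List (Fin n))} → Valid L → All Nonempty (map subset L)
valid⇒nonempty []                    = []
valid⇒nonempty (block {m} {ws} _ _ v) = (m , ∈-subset⁺ {xs = m ∷ ws} (here refl)) ∷ valid⇒nonempty v

unique⇒disjoint : (L : List (List (Fin n))) → Unique (concat L) →
                  AllPairs (λ p q → Empty (p ∩ q)) (map subset L)
unique⇒disjoint []      _ = []
unique⇒disjoint (l ∷ L) u =
  Allₚ.map⁺ (All.tabulate λ {l′} l′∈L (i , i∈) →
    let i∈l , i∈l′ = x∈p∩q⁻ (subset l) (subset l′) i∈ in
    Unique-++-∉ l u (∈-subset⁻ l i∈l) (∈-concat⁺′ (∈-subset⁻ l′ i∈l′) l′∈L))
  ∷ unique⇒disjoint L (proj₁ (proj₂ (++⁻ l u)))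

valid⇒sorted : {L : List (List (Fin n))} → Valid L → AllPairs _≺_ (map subset L)
valid⇒sorted [] = []
valid⇒sorted (block {m} {ws} _ m<L v) =
  Allₚ.map⁺ (All.tabulate λ {l} l∈L → min-≺ (∈-subset⁺ {xs = m ∷ ws} (here refl))
    λ j∈ → All.lookup m<L (∈-concat⁺′ (∈-subset⁻ l j∈) l∈L))
  ∷ valid⇒sorted v

∈-concat-elements⁻ : {i : Fin n} (P : List (Subset n)) → i ∈ concat (map elements P) → ∃ λ p → p ∈ P × i ∈ˢ p
∈-concat-elements⁻ P i∈ with ∈-concat⁻′ (map elements P) i∈
... | l , i∈l , l∈ with ∈-map⁻ elements l∈
... | p , p∈P , refl = p , p∈P , ∈-elements⁻ p i∈l

partition⇒valid : (P : List (Subset n)) → AllPairs _≺_ P → All Nonempty P →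
                  AllPairs (λ p q → Empty (p ∩ q)) P → Valid (map elements P)
partition⇒valid []      _          _                   _        = []
partition⇒valid (p ∷ P) (p≺P ∷ sP) ((i , i∈p) ∷ neP) (p#P ∷ dP)
  -- The last abstracted term becomes a proof of `i ∈ []` when `elements p` is empty, which excludes
  -- that case. The third one is abstracted along so that it speaks of `m ∷ ws`.
  with elements p | elements-sorted p | (λ k → ∈-elements⁺ {i = k} p) | ∈-elements⁺ p i∈p
... | m ∷ ws | s@(m<ws ∷ _) | ∈p⇒ | _ = block s (All.tabulate m<) (partition⇒valid P sP neP dP)
  where
  m< : ∀ {j} → j ∈ concat (map elements P) → m < j
  m< j∈ with ∈-concat-elements⁻ P j∈
  -- The element `k` of `p` below `j` need not be shown minimal: the head `m` of the sorted list is
  -- at most `k`.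
  ... | q , q∈P , j∈q with ≺-min (All.lookup p≺P q∈P) (All.lookup p#P q∈P) j∈q
  ... | k , k∈p , k<j with ∈p⇒ k k∈p
  ... | here refl  = k<j
  ... | there k∈ws = <-trans (All.lookup m<ws k∈ws) k<j

partition⇒unique : (P : List (Subset n)) → AllPairs (λ p q → Empty (p ∩ q)) P →
                   Unique (concat (map elements P))
partition⇒unique P dP = Uniqueₚ.concat⁺
  (Allₚ.map⁺ (All.universal (λ p → AllPairs.map (λ i<j i≡j → <-irrefl i≡j i<j) (elements-sorted p)) P))
  (AllPairsₚ.map⁺ (AllPairs.map (λ {p} {q} p#q {_} (i∈p , i∈q) →
    p#q (_ , x∈p∩q⁺ (∈-elements⁻ p i∈p , ∈-elements⁻ q i∈q))) dP))

toPartition-∈ : (π : Word n) → Unique (toList π) → Avoids32-1 (toList π) → toPartition π ∈ setPartitions n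
toPartition-∈ π u av = ∈-filter⁺ isSetPartition?
  -- A family keeps the order of `subsets n`, so membership requires the blocks to be listed in
  -- exactly that order; increasing minima provide it.
  (∈-sublists⁺ (sorted-⊆ ≺-asym (valid⇒sorted valid) (subsets-sorted _) (λ {p} _ → ∈-subsets p)))
  ( valid⇒nonempty valid
  , unique⇒disjoint L (Unique-resp-↭ π↭L u)
  , λ i → Anyₚ.map⁺ (Any.map ∈-subset⁺
      (∈-concat⁻ L (∈-resp-↭ π↭L (unique-word-full π (Unique⇒Vecᵁ π u) i)))))
  where
  L = blocks (toList π)
  valid = blocks-valid (toList π) u av
  π↭L : toList π ↭ concat L
  π↭L = subst (_↭ concat L) (word-blocks (toList π)) (word-↭ L)

fromPartition-avoids : (P : List (Subset n)) → P ∈ setPartitions n →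
  ∃ λ (π : Word n) → Unique (toList π) × Avoids32-1 (toList π) × toPartition π ≡ P
fromPartition-avoids {n} P P∈ with ∈-filter⁻ isSetPartition? {xs = families n} P∈
... | P∈families , neP , dP , cover =
  π , subst Unique (sym π≡w) w! , subst Avoids32-1 (sym π≡w) (word-avoids valid)
    , trans (cong (map subset ∘ blocks) π≡w)
        (trans (cong (map subset) (blocks-word valid)) (map-subset-elements P))
  where
  w = fromPartition P
  valid : Valid (map elements P)
  -- Conversely, a family inherits the order `≺` from `subsets n`, so its blocks already come by
  -- increasing minima.
  valid = partition⇒valid P (AllPairs-⊆ (∈-sublists⁻ (subsets n) P∈families) (subsets-sorted n)) neP dP
  w↭ : w ↭ concat (map elements P)
  w↭ = word-↭ (map elements P)
  w! : Unique w
  w! = Unique-resp-↭ (↭-sym w↭) (partition⇒unique P dP)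
  full : ∀ i → i ∈ w
  full i = ∈-resp-↭ (↭-sym w↭) (∈-concat⁺ (Anyₚ.map⁺ (Any.map (∈-elements⁺ _) (cover i))))
  -- `w` and `allFin n` are free of repetition and have the same members; the resulting length makes
  -- `w` a `Word n`.
  w-length : length w ≡ n
  w-length = trans (unique-length w! (Uniqueₚ.allFin⁺ n) (λ _ → ∈-allFin _) (λ _ → full _))
                   (length-tabulate id)
  π = proj₁ (vecOfLength w w-length)
  π≡w = proj₂ (vecOfLength w w-length)

∈-avoiders⁻ : (π : Word n) → π ∈ avoiders n ⟨31∶3→2⟩ → Unique (toList π) × Avoids32-1 (toList π)
∈-avoiders⁻ {n} π π∈ with ∈-filter⁻ (avoids? ⟨31∶3→2⟩) {xs = permutations n} π∈
... | π∈perm , av with ∈-filter⁻ (Vecᴾ.allPairs? λ a b → ¬? (a ≟ b)) {xs = vecs (allFin n) n} π∈perm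
... | _ , u = Vecᵁ⇒Unique u , avoids⇒avoids32-1 π (Vecᵁ⇒Unique u) av

∈-avoiders⁺ : (π : Word n) → Unique (toList π) → Avoids32-1 (toList π) → π ∈ avoiders n ⟨31∶3→2⟩
∈-avoiders⁺ π u av = ∈-filter⁺ (avoids? ⟨31∶3→2⟩)
  (∈-filter⁺ (Vecᴾ.allPairs? λ a b → ¬? (a ≟ b)) (∈-vecs⁺ ∈-allFin π) (Unique⇒Vecᵁ π u))
  (avoids32-1⇒avoids π u av)

-- The blocks of an avoider are valid, so `fromPartition` recovers its list of entries from the
-- partition.
toPartition-injective : {π ρ : Word n} → π ∈ avoiders n ⟨31∶3→2⟩ → ρ ∈ avoiders n ⟨31∶3→2⟩ →
                        toPartition π ≡ toPartition ρ → π ≡ ρ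
toPartition-injective {π = π} {ρ} π∈ ρ∈ eq =
  trans (sym (cast-is-id refl π)) (toList-injective refl π ρ
    (trans (sym (invert π π∈)) (trans (cong fromPartition eq) (invert ρ ρ∈))))
  where
  invert : ∀ σ → σ ∈ avoiders _ ⟨31∶3→2⟩ → fromPartition (toPartition σ) ≡ toList σ
  invert σ σ∈ = let u , av = ∈-avoiders⁻ σ σ∈ in
    fromPartition-toPartition σ (blocks-valid (toList σ) u av)

avoiders-unique : ∀ n → Unique (avoiders n ⟨31∶3→2⟩)
avoiders-unique n = Uniqueₚ.filter⁺ (avoids? ⟨31∶3→2⟩)
  (Uniqueₚ.filter⁺ (Vecᴾ.allPairs? λ a b → ¬? (a ≟ b)) (vecs-unique (Uniqueₚ.allFin⁺ n) n))

setPartitions-unique : ∀ n → Unique (setPartitions n)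
setPartitions-unique n = Uniqueₚ.filter⁺ isSetPartition?
  (sublists-unique (vecs-unique (((λ ()) ∷ []) ∷ [] ∷ []) n))

theorem4p3 : ∀ (n : ℕ) → n ≥ 1 → length (avoiders n ⟨31∶3→2⟩) ≡ bell n
theorem4p3 n _ = trans (sym (length-map toPartition (avoiders n ⟨31∶3→2⟩)))
  -- Injectivity keeps the list of images free of repetition; it then suffices that it has the same
  -- members as `setPartitions n`.
  (unique-length (Unique-map⁺ toPartition-injective (avoiders-unique n)) (setPartitions-unique n) to from)
  where
  to : ∀ {P} → P ∈ map toPartition (avoiders n ⟨31∶3→2⟩) → P ∈ setPartitions n
  to P∈ with ∈-map⁻ toPartition P∈
  ... | π , π∈ , refl = let u , av = ∈-avoiders⁻ π π∈ in toPartition-∈ π u av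

  from : ∀ {P} → P ∈ setPartitions n → P ∈ map toPartition (avoiders n ⟨31∶3→2⟩)
  from {P} P∈ with fromPartition-avoids P P∈
  ... | π , u , av , refl = ∈-map⁺ toPartition (∈-avoiders⁺ π u av)
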